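{- Let $\mathsf{Sup}$ be the Hilbert system described in the context. For every instance, within the flat fragment of the language of Åqvist's system $\mathbb{F}$, of the axioms $\mathbf{CL}$, $\mathbf{K_\Box}$, $\mathbf{T}$, $\mathbf{COK}$, $\mathbf{Nec}$, $\mathbf{Ext}$, $\mathbf{ID}$, $\mathbf{SH}$, $\mathbf{D^*}$ of $\mathbb{F}$, its translation $^*$ is derivable in $\mathsf{Sup}$; moreover the translations of the rules of $\mathbb{F}$ are derivable in $\mathsf{Sup}$: modus ponens, and necessitation for $\Box$, i.e. if $\varphi$ is propositional and $\vdash\varphi$ then $\vdash \neg\varphi\rightsquigarrow\bot$. (The axioms $\mathbf{5}$ and $\mathbf{Abs}$ of $\mathbb{F}$ are excluded.)
   Context: Propositional formulas: $\varphi ::= \bot \mid p \mid \varphi\land\varphi\mid\varphi\lor\varphi\mid\varphi\to\varphi\mid\varphi\leftrightarrow\varphi\mid\neg\varphi$ over a countable set of variables. The language $\mathcal{L}$: $\alpha ::= \varphi \mid \varphi\rightsquigarrow\varphi \mid B(\alpha)\mid \alpha*\alpha\mid\neg\alpha$ ($*$ a binary classical connective, $\varphi$ propositional). The system $\mathsf{Sup}$ has all classical tautologies over $\mathcal{L}$, Modus Ponens, and (with $\varphi,\psi,\chi,\varphi_i,\psi_i$ propositional, rule outputs required to lie in $\mathcal{L}$): $\mathbf{ID}$: $\varphi\rightsquigarrow\varphi$; $\mathbf{ST}$: $(\varphi\rightsquigarrow\bot)\to\neg\varphi$; $\mathbf{SH}$: $((\psi\land\chi)\rightsquigarrow\varphi)\to(\psi\rightsquigarrow(\chi\to\varphi))$;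 $\mathbf{LL+}$: $(\neg(\varphi\leftrightarrow\psi)\rightsquigarrow\bot)\to((\varphi\rightsquigarrow\chi)\leftrightarrow(\psi\rightsquigarrow\chi))$; rule $\mathbf{RCK}$: from $(\varphi_1\land\dots\land\varphi_n)\to\varphi_{n+1}$ infer $((\psi\rightsquigarrow\varphi_1)\land\dots\land(\psi\rightsquigarrow\varphi_n))\to(\psi\rightsquigarrow\varphi_{n+1})$; rule $\mathbf{S5_F}$: from $(\ell_1\land\dots\land\ell_n)\to\chi$ infer $(\ell_1\land\dots\land\ell_n)\to(\neg\chi\rightsquigarrow\bot)$, where each $\ell_j$ is $\varphi_j\rightsquigarrow\psi_j$ or $\neg(\varphi_j\rightsquigarrow\psi_j)$ and $\chi$ is propositional. Åqvist's system $\mathbb{F}$ has language with $\Box$, $\lozenge$ and dyadic $\bigcirc(\psi/\varphi)$ and axioms: $\mathbf{CL}$ (tautologies); $\mathbf{K_\Box}$: $\Box(\varphi\to\psi)\to(\Box\varphi\to\Box\psi)$; $\mathbf{T}$: $\Box\varphi\to\varphi$; $\mathbf{5}$: $\lozenge\varphi\to\Box\lozenge\varphi$; $\mathbf{COK}$: $\bigcirc(\psi\to\chi/\varphi)\to(\bigcirc(\psi/\varphi)\to\bigcirc(\chi/\varphi))$; $\mathbf{Abs}$: $\bigcirc(\varphi/\psi)\to\Box\bigcirc(\varphi/\psi)$; $\mathbf{Nec}$: $\Box\varphi\to\bigcirc(\varphi/\psi)$; $\mathbf{Ext}$: $\Box(\varphi\leftrightarrow\psi)\to(\bigcirc(\chi/\varphi)\leftrightarrow\bigcirc(\chi/\psi))$;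 $\mathbf{ID}$: $\bigcirc(\varphi/\varphi)$; $\mathbf{SH}$: $\bigcirc(\varphi/\psi\land\chi)\to\bigcirc(\chi\to\varphi/\psi)$; $\mathbf{D^*}$: $\lozenge\psi\to(\bigcirc(\varphi/\psi)\to\neg\bigcirc(\neg\varphi/\psi))$; rules: modus ponens and necessitation for $\Box$. The flat fragment consists of formulas in which $\Box,\lozenge,\bigcirc$ are applied only to propositional formulas. The translation $^*$ maps flat formulas to $\mathcal{L}$: $\varphi^*=\varphi$ for propositional $\varphi$, $(\Box\varphi)^*=\neg\varphi\rightsquigarrow\bot$, $(\lozenge\varphi)^*=\neg(\varphi\rightsquigarrow\bot)$, $(\bigcirc(\psi/\varphi))^*=\varphi\rightsquigarrow\psi$, and $^*$ commutes with the Boolean connectives. -}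

module Defs where

open import Data.Bool as Bool using (Bool; true; false; not)
open import Data.Empty using (⊥)
open import Data.List.NonEmpty using (List⁺; map; foldr₁)
open import Data.Nat using (ℕ)
open import Data.Product using (_×_; proj₁; proj₂)
open import Data.Unit using (⊤)
open import Relation.Binary.PropositionalEquality using (_≡_)

infix  9 ~_
infixr 8 _∧_
infixr 7 _∨_
infixr 6 _⇒_
infix  5 _⇔_
infix  8 _⇝_
infix  2 ⊢_

data PForm : Set where
  bot             : PForm
  var             : ℕ → PForm
  _∧_ _∨_ _⇒_ _⇔_ : PForm → PForm → PForm
  ~_              : PForm → PForm

-- The language 𝓛.  A Boolean compound of propositional formulas is a single
-- formula of 𝓛, so the clause "every propositional φ is in 𝓛" is rendered by
-- the atoms bot and var together with the embedding ⌜_⌝, not by a constructor.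
data Form : Set where
  bot             : Form
  var             : ℕ → Form
  _⇝_             : PForm → PForm → Form
  B               : Form → Form
  _∧_ _∨_ _⇒_ _⇔_ : Form → Form → Form
  ~_              : Form → Form

⌜_⌝ : PForm → Form
⌜ bot ⌝   = bot
⌜ var p ⌝ = var p
⌜ φ ∧ ψ ⌝ = ⌜ φ ⌝ ∧ ⌜ ψ ⌝
⌜ φ ∨ ψ ⌝ = ⌜ φ ⌝ ∨ ⌜ ψ ⌝
⌜ φ ⇒ ψ ⌝ = ⌜ φ ⌝ ⇒ ⌜ ψ ⌝
⌜ φ ⇔ ψ ⌝ = ⌜ φ ⌝ ⇔ ⌜ ψ ⌝
⌜ ~ φ ⌝   = ~ ⌜ φ ⌝

-- The language of Åqvist's 𝔽, with unrestricted nesting;  ○ ψ / φ  is the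
-- obligation of ψ given φ.
data FForm : Set where
  bot             : FForm
  var             : ℕ → FForm
  _∧_ _∨_ _⇒_ _⇔_ : FForm → FForm → FForm
  ~_              : FForm → FForm
  □_ ◇_           : FForm → FForm
  ○_/_            : FForm → FForm → FForm

infix 9 □_ ◇_
infix 9 ○_/_

_implies_ _iff_ : Bool → Bool → Bool
a implies b = not a Bool.∨ b
a iff b     = (a implies b) Bool.∧ (b implies a)

-- The valuation v is consulted only at formulas whose main operator is not
-- Boolean: variables, conditionals, and B-formulas.
eval : (Form → Bool) → Form → Bool
eval v bot     = false
eval v (var p) = v (var p)
eval v (φ ⇝ ψ) = v (φ ⇝ ψ)
eval v (B α)   = v (B α)
eval v (α ∧ β) = eval v α Bool.∧ eval v β
eval v (α ∨ β) = eval v α Bool.∨ eval v β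
eval v (α ⇒ β) = eval v α implies eval v β
eval v (α ⇔ β) = eval v α iff eval v β
eval v (~ α)   = not (eval v α)

Tautology : Form → Set
Tautology α = ∀ v → eval v α ≡ true

evalF : (FForm → Bool) → FForm → Bool
evalF v bot         = false
evalF v (var p)     = v (var p)
evalF v (C ∧ D)     = evalF v C Bool.∧ evalF v D
evalF v (C ∨ D)     = evalF v C Bool.∨ evalF v D
evalF v (C ⇒ D)     = evalF v C implies evalF v D
evalF v (C ⇔ D)     = evalF v C iff evalF v D
evalF v (~ C)       = not (evalF v C)
evalF v (□ C)       = v (□ C)
evalF v (◇ C)       = v (◇ C)
evalF v (○ D / C)   = v (○ D / C)

TautologyF : FForm → Set
TautologyF C = ∀ v → evalF v C ≡ true

⋀ᴾ : List⁺ PForm → PForm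
⋀ᴾ = foldr₁ _∧_

⋀ : List⁺ Form → Form
⋀ = foldr₁ _∧_

data Literal : Set where
  pos neg : PForm → PForm → Literal

⌊_⌋ : Literal → Form
⌊ pos φ ψ ⌋ = φ ⇝ ψ
⌊ neg φ ψ ⌋ = ~ (φ ⇝ ψ)

-- Derivability in Sup.  RCK and S5F are taken with n ≥ 1; their n = 0 cases
-- are derivable by adding an instance of ID as a dummy conjunct.
data ⊢_ : Form → Set where
  CL  : ∀ {α} → Tautology α → ⊢ α
  MP  : ∀ {α β} → ⊢ α ⇒ β → ⊢ α → ⊢ β
  ID  : ∀ φ → ⊢ φ ⇝ φ
  ST  : ∀ φ → ⊢ (φ ⇝ bot) ⇒ ~ ⌜ φ ⌝
  SH  : ∀ φ ψ χ → ⊢ ((ψ ∧ χ) ⇝ φ) ⇒ (ψ ⇝ (χ ⇒ φ))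
  LL+ : ∀ φ ψ χ → ⊢ ((~ (φ ⇔ ψ)) ⇝ bot) ⇒ ((φ ⇝ χ) ⇔ (ψ ⇝ χ))
  RCK : ∀ (φs : List⁺ PForm) φ ψ →
        ⊢ ⌜ ⋀ᴾ φs ⇒ φ ⌝ → ⊢ ⋀ (map (ψ ⇝_) φs) ⇒ (ψ ⇝ φ)
  S5F : ∀ (ℓs : List⁺ Literal) χ →
        ⊢ ⋀ (map ⌊_⌋ ℓs) ⇒ ⌜ χ ⌝ → ⊢ ⋀ (map ⌊_⌋ ℓs) ⇒ ((~ χ) ⇝ bot)

-- Instances of the axiom schemata of 𝔽 other than 5 and Abs.
data Axiom : FForm → Set where
  CL  : ∀ {C} → TautologyF C → Axiom C
  K□  : ∀ φ ψ → Axiom (□ (φ ⇒ ψ) ⇒ (□ φ ⇒ □ ψ))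
  T   : ∀ φ → Axiom (□ φ ⇒ φ)
  COK : ∀ φ ψ χ → Axiom ((○ (ψ ⇒ χ) / φ) ⇒ ((○ ψ / φ) ⇒ (○ χ / φ)))
  Nec : ∀ φ ψ → Axiom (□ φ ⇒ (○ φ / ψ))
  Ext : ∀ φ ψ χ → Axiom (□ (φ ⇔ ψ) ⇒ ((○ χ / φ) ⇔ (○ χ / ψ)))
  ID  : ∀ φ → Axiom (○ φ / φ)
  SH  : ∀ φ ψ χ → Axiom ((○ φ / (ψ ∧ χ)) ⇒ (○ (χ ⇒ φ) / ψ))
  D*  : ∀ φ ψ → Axiom (◇ ψ ⇒ ((○ φ / ψ) ⇒ ~ (○ (~ φ) / ψ)))

Propositional : FForm → Set
Propositional bot       = ⊤
Propositional (var p)   = ⊤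
Propositional (C ∧ D)   = Propositional C × Propositional D
Propositional (C ∨ D)   = Propositional C × Propositional D
Propositional (C ⇒ D)   = Propositional C × Propositional D
Propositional (C ⇔ D)   = Propositional C × Propositional D
Propositional (~ C)     = Propositional C
Propositional (□ C)     = ⊥
Propositional (◇ C)     = ⊥
Propositional (○ D / C) = ⊥

Flat : FForm → Set
Flat bot       = ⊤
Flat (var p)   = ⊤
Flat (C ∧ D)   = Flat C × Flat D
Flat (C ∨ D)   = Flat C × Flat D
Flat (C ⇒ D)   = Flat C × Flat D
Flat (C ⇔ D)   = Flat C × Flat D
Flat (~ C)     = Flat C
Flat (□ C)     = Propositional C
Flat (◇ C)     = Propositional C
Flat (○ D / C) = Propositional D × Propositional C

-- The evidence arguments of toP and _*[_] are irrelevant, so the results depend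
-- on the formula alone.
toP : (C : FForm) → .(Propositional C) → PForm
toP bot     _ = bot
toP (var p) _ = var p
toP (C ∧ D) p = toP C (proj₁ p) ∧ toP D (proj₂ p)
toP (C ∨ D) p = toP C (proj₁ p) ∨ toP D (proj₂ p)
toP (C ⇒ D) p = toP C (proj₁ p) ⇒ toP D (proj₂ p)
toP (C ⇔ D) p = toP C (proj₁ p) ⇔ toP D (proj₂ p)
toP (~ C)   p = ~ toP C p

infix 10 _*[_]

_*[_] : (C : FForm) → .(Flat C) → Form
bot *[ _ ]       = bot
var p *[ _ ]     = var p
(C ∧ D) *[ f ]   = C *[ proj₁ f ] ∧ D *[ proj₂ f ]
(C ∨ D) *[ f ]   = C *[ proj₁ f ] ∨ D *[ proj₂ f ]
(C ⇒ D) *[ f ]   = C *[ proj₁ f ] ⇒ D *[ proj₂ f ]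
(C ⇔ D) *[ f ]   = C *[ proj₁ f ] ⇔ D *[ proj₂ f ]
(~ C) *[ f ]     = ~ (C *[ f ])
(□ C) *[ f ]     = (~ toP C f) ⇝ bot
(◇ C) *[ f ]     = ~ (toP C f ⇝ bot)
(○ D / C) *[ f ] = toP C (proj₂ f) ⇝ toP D (proj₁ f)

{-# OPTIONS --safe #-}
-- ST makes □φ := ¬φ ⇝ ⊥ factive, and S5F promotes every propositional
-- consequence of boxed formulas to a boxed consequence; together these give K□
-- and necessitation.  For Nec, □φ yields □(ψ ↔ ψ ∧ φ), so LL+ reduces ψ ⇝ φ to
-- (ψ ∧ φ) ⇝ φ, which follows from ID and RCK.  COK and D* are instances of RCK.
module Submission where

open import Data.Bool as Bool using (Bool; true; false; not)
open import Data.List using ([]; _∷_)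
open import Data.List.NonEmpty using (_∷_)
open import Data.Product using (_×_; _,_)
open import Relation.Binary.PropositionalEquality using (_≡_; refl; sym; trans; cong; cong₂; subst)
open import Defs

-- `eval v` commutes with the connectives, so in this and the following schemata a truth table
-- `taut` over arbitrary Booleans establishes the tautology that `CL` asks for.
⇒-trans : ∀ {α β γ} → ⊢ α ⇒ β → ⊢ β ⇒ γ → ⊢ α ⇒ γ
⇒-trans {α} {β} {γ} p q =
  MP (MP (CL λ v → taut (eval v α) (eval v β) (eval v γ)) p) q
  where
  taut : ∀ a b c → ((a implies b) implies ((b implies c) implies (a implies c))) ≡ true
  taut true  true  true  = refl
  taut true  true  false = refl
  taut true  false c     = refl
  taut false true  true  = refl
  taut false true  false = refl
  taut false false c     = refl

⇒-const : ∀ {α β} → ⊢ α → ⊢ β ⇒ α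
⇒-const {α} {β} = MP (CL λ v → taut (eval v α) (eval v β))
  where
  taut : ∀ a b → (a implies (b implies a)) ≡ true
  taut true  true  = refl
  taut true  false = refl
  taut false b     = refl

⇒-curry : ∀ {α β γ} → ⊢ (α ∧ β) ⇒ γ → ⊢ α ⇒ (β ⇒ γ)
⇒-curry {α} {β} {γ} = MP (CL λ v → taut (eval v α) (eval v β) (eval v γ))
  where
  taut : ∀ a b c → (((a Bool.∧ b) implies c) implies (a implies (b implies c))) ≡ true
  taut true  true  true  = refl
  taut true  true  false = refl
  taut true  false c     = refl
  taut false b     c     = refl

⇒-apply : ∀ {α β γ δ} → ⊢ α ⇒ (γ ⇒ δ) → ⊢ β ⇒ γ → ⊢ (α ∧ β) ⇒ δ
⇒-apply {α} {β} {γ} {δ} p q =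
  MP (MP (CL λ v → taut (eval v α) (eval v β) (eval v γ) (eval v δ)) p) q
  where
  taut : ∀ a b c d →
         ((a implies (c implies d)) implies ((b implies c) implies ((a Bool.∧ b) implies d))) ≡ true
  taut true  true  true  true  = refl
  taut true  true  true  false = refl
  taut true  true  false d     = refl
  taut true  false true  true  = refl
  taut true  false true  false = refl
  taut true  false false d     = refl
  taut false true  true  d     = refl
  taut false true  false d     = refl
  taut false false c     d     = refl

⇒-contrapose : ∀ {α β γ} → ⊢ (α ∧ β) ⇒ γ → ⊢ (~ γ) ⇒ (α ⇒ ~ β)
⇒-contrapose {α} {β} {γ} = MP (CL λ v → taut (eval v α) (eval v β) (eval v γ))
  where
  taut : ∀ a b c → (((a Bool.∧ b) implies c) implies (not c implies (a implies not b))) ≡ true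
  taut true  true  true  = refl
  taut true  true  false = refl
  taut true  false true  = refl
  taut true  false false = refl
  taut false b     true  = refl
  taut false b     false = refl

⇔-elimʳ : ∀ {α β γ} → ⊢ α ⇒ (β ⇔ γ) → ⊢ γ → ⊢ α ⇒ β
⇔-elimʳ {α} {β} {γ} p q =
  MP (MP (CL λ v → taut (eval v α) (eval v β) (eval v γ)) p) q
  where
  taut : ∀ a b c → ((a implies (b iff c)) implies (c implies (a implies b))) ≡ true
  taut true  true  true  = refl
  taut true  true  false = refl
  taut true  false true  = refl
  taut true  false false = refl
  taut false b     true  = refl
  taut false b     false = refl

~~-elim : ∀ α → ⊢ (~ ~ α) ⇒ α
~~-elim α = CL λ v → taut (eval v α)
  where
  taut : ∀ a → (not (not a) implies a) ≡ true
  taut true  = refl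
  taut false = refl

⇒-absorb : ∀ α β → ⊢ α ⇒ (β ⇔ (β ∧ α))
⇒-absorb α β = CL λ v → taut (eval v α) (eval v β)
  where
  taut : ∀ a b → (a implies (b iff (b Bool.∧ a))) ≡ true
  taut true  true  = refl
  taut true  false = refl
  taut false b     = refl

∧-elimʳ : ∀ α β → ⊢ (α ∧ β) ⇒ β
∧-elimʳ α β = CL λ v → taut (eval v α) (eval v β)
  where
  taut : ∀ a b → ((a Bool.∧ b) implies b) ≡ true
  taut true  true  = refl
  taut true  false = refl
  taut false b     = refl

⇒-mp : ∀ α β → ⊢ ((α ⇒ β) ∧ α) ⇒ β
⇒-mp α β = CL λ v → taut (eval v α) (eval v β)
  where
  taut : ∀ a b → (((a implies b) Bool.∧ a) implies b) ≡ true
  taut true  true  = refl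
  taut true  false = refl
  taut false b     = refl

∧-contradiction : ∀ α → ⊢ (α ∧ (~ α)) ⇒ bot
∧-contradiction α = CL λ v → taut (eval v α)
  where
  taut : ∀ a → ((a Bool.∧ not a) implies false) ≡ true
  taut true  = refl
  taut false = refl

□-factive : ∀ φ → ⊢ ((~ φ) ⇝ bot) ⇒ ⌜ φ ⌝
□-factive φ = ⇒-trans (ST (~ φ)) (~~-elim ⌜ φ ⌝)

-- The two boxed hypotheses are positive literals. Factivity extracts `φ ⇒ ψ` and `φ` from them,
-- hence `ψ`, and `S5F` boxes that conclusion again.
□-K : ∀ φ ψ → ⊢ ((~ (φ ⇒ ψ)) ⇝ bot) ⇒ (((~ φ) ⇝ bot) ⇒ ((~ ψ) ⇝ bot))
□-K φ ψ = ⇒-curry (S5F (pos (~ (φ ⇒ ψ)) bot ∷ pos (~ φ) bot ∷ []) ψ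
                       (⇒-apply (□-factive (φ ⇒ ψ)) (□-factive φ)))

□-necessitation : ∀ φ → ⊢ ⌜ φ ⌝ → ⊢ (~ φ) ⇝ bot
-- `S5F` takes a nonempty list of literals; `bot ⇝ bot` serves as a dummy and is discharged by `ID`.
□-necessitation φ p = MP (S5F (pos bot bot ∷ []) φ (⇒-const p)) (ID bot)

⇝-K : ∀ φ ψ χ → ⊢ (φ ⇝ (ψ ⇒ χ)) ⇒ ((φ ⇝ ψ) ⇒ (φ ⇝ χ))
⇝-K φ ψ χ = ⇒-curry (RCK ((ψ ⇒ χ) ∷ ψ ∷ []) χ φ (⇒-mp ⌜ ψ ⌝ ⌜ χ ⌝))

□⇒⇝ : ∀ φ ψ → ⊢ ((~ φ) ⇝ bot) ⇒ (ψ ⇝ φ)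
□⇒⇝ φ ψ = ⇔-elimʳ (⇒-trans □-absorb (LL+ ψ (ψ ∧ φ) φ)) ψ∧φ⇝φ
  where
  □-absorb : ⊢ ((~ φ) ⇝ bot) ⇒ ((~ (ψ ⇔ (ψ ∧ φ))) ⇝ bot)
  □-absorb = S5F (pos (~ φ) bot ∷ []) (ψ ⇔ (ψ ∧ φ))
                 (⇒-trans (□-factive φ) (⇒-absorb ⌜ φ ⌝ ⌜ ψ ⌝))

  ψ∧φ⇝φ : ⊢ (ψ ∧ φ) ⇝ φ
  ψ∧φ⇝φ = MP (RCK ((ψ ∧ φ) ∷ []) φ (ψ ∧ φ) (∧-elimʳ ⌜ ψ ⌝ ⌜ φ ⌝)) (ID (ψ ∧ φ))

-- `RCK` applied to the contradiction of `φ` with `~ φ` turns two conflicting conditionals into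
-- `ψ ⇝ bot`, whose negation translates `◇ ψ`.
⇝-D* : ∀ φ ψ → ⊢ (~ (ψ ⇝ bot)) ⇒ ((ψ ⇝ φ) ⇒ ~ (ψ ⇝ (~ φ)))
⇝-D* φ ψ = ⇒-contrapose (RCK (φ ∷ (~ φ) ∷ []) bot ψ (∧-contradiction ⌜ φ ⌝))

-- Needed for `T`, where the same formula occurs under `□`, translated by `toP`, and bare,
-- translated by `_*[_]`. Modal cases are vacuous, since `Propositional` is empty there.
*-propositional : ∀ C (f : Flat C) (p : Propositional C) → C *[ f ] ≡ ⌜ toP C p ⌝
*-propositional bot     f p = refl
*-propositional (var x) f p = refl
*-propositional (C ∧ D) (f , g) (p , q) = cong₂ _∧_ (*-propositional C f p) (*-propositional D g q)
*-propositional (C ∨ D) (f , g) (p , q) = cong₂ _∨_ (*-propositional C f p) (*-propositional D g q)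
*-propositional (C ⇒ D) (f , g) (p , q) = cong₂ _⇒_ (*-propositional C f p) (*-propositional D g q)
*-propositional (C ⇔ D) (f , g) (p , q) = cong₂ _⇔_ (*-propositional C f p) (*-propositional D g q)
*-propositional (~ C)   f p = cong ~_ (*-propositional C f p)

-- Total version of toP, with junk value bot at modal formulas; a valuation on
-- FForm has no flatness evidence to pass to toP.
toP₀ : FForm → PForm
toP₀ bot     = bot
toP₀ (var x) = var x
toP₀ (C ∧ D) = toP₀ C ∧ toP₀ D
toP₀ (C ∨ D) = toP₀ C ∨ toP₀ D
toP₀ (C ⇒ D) = toP₀ C ⇒ toP₀ D
toP₀ (C ⇔ D) = toP₀ C ⇔ toP₀ D
toP₀ (~ C)   = ~ toP₀ C
toP₀ (□ C)     = bot
toP₀ (◇ C)     = bot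
toP₀ (○ D / C) = bot

toP₀≡toP : ∀ C (p : Propositional C) → toP₀ C ≡ toP C p
toP₀≡toP bot     p = refl
toP₀≡toP (var x) p = refl
toP₀≡toP (C ∧ D) (p , q) = cong₂ _∧_ (toP₀≡toP C p) (toP₀≡toP D q)
toP₀≡toP (C ∨ D) (p , q) = cong₂ _∨_ (toP₀≡toP C p) (toP₀≡toP D q)
toP₀≡toP (C ⇒ D) (p , q) = cong₂ _⇒_ (toP₀≡toP C p) (toP₀≡toP D q)
toP₀≡toP (C ⇔ D) (p , q) = cong₂ _⇔_ (toP₀≡toP C p) (toP₀≡toP D q)
toP₀≡toP (~ C)   p = cong ~_ (toP₀≡toP C p)

-- Each atom of the source language receives the value of its translation; `◇` translates to a
-- negation, hence the `not`.
pullback : (Form → Bool) → FForm → Bool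
pullback v (var x)   = v (var x)
pullback v (□ C)     = v ((~ toP₀ C) ⇝ bot)
pullback v (◇ C)     = not (v (toP₀ C ⇝ bot))
pullback v (○ D / C) = v (toP₀ C ⇝ toP₀ D)
-- Only `bot` and Boolean compounds remain, where `evalF` never consults the valuation.
pullback v _         = false

evalF-pullback : ∀ v C (f : Flat C) → evalF (pullback v) C ≡ eval v (C *[ f ])
evalF-pullback v bot     f = refl
evalF-pullback v (var x) f = refl
evalF-pullback v (C ∧ D) (f , g) = cong₂ Bool._∧_ (evalF-pullback v C f) (evalF-pullback v D g)
evalF-pullback v (C ∨ D) (f , g) = cong₂ Bool._∨_ (evalF-pullback v C f) (evalF-pullback v D g)
evalF-pullback v (C ⇒ D) (f , g) = cong₂ _implies_ (evalF-pullback v C f) (evalF-pullback v D g)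
evalF-pullback v (C ⇔ D) (f , g) = cong₂ _iff_ (evalF-pullback v C f) (evalF-pullback v D g)
evalF-pullback v (~ C)   f = cong not (evalF-pullback v C f)
evalF-pullback v (□ C)   f = cong (λ φ → v ((~ φ) ⇝ bot)) (toP₀≡toP C f)
evalF-pullback v (◇ C)   f = cong (λ φ → not (v (φ ⇝ bot))) (toP₀≡toP C f)
evalF-pullback v (○ D / C) (q , p) = cong₂ (λ φ ψ → v (φ ⇝ ψ)) (toP₀≡toP C p) (toP₀≡toP D q)

-- The translation acts as a substitution for the modal atoms, possibly identifying some of them,
-- and tautologies are closed under substitution: a valuation refuting the translation pulls back to
-- one refuting `C`.
*-tautology : ∀ C (f : Flat C) → TautologyF C → Tautology (C *[ f ])
*-tautology C f t v = trans (sym (evalF-pullback v C f)) (t (pullback v))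

axiom-derivable : (C : FForm) (f : Flat C) → Axiom C → ⊢ C *[ f ]
axiom-derivable C f (CL t) = CL (*-tautology C f t)
-- Evidence passed to `toP` is irrelevant, so repeated occurrences of a formula have definitionally
-- equal translations and one witness serves them all.
axiom-derivable _ ((p , q) , _) (K□ φ ψ) = □-K (toP φ p) (toP ψ q)
axiom-derivable _ (p , f) (T φ) =
  subst (λ α → ⊢ ((~ toP φ p) ⇝ bot) ⇒ α) (sym (*-propositional φ f p)) (□-factive (toP φ p))
axiom-derivable _ (((q , r) , p) , _) (COK φ ψ χ) = ⇝-K (toP φ p) (toP ψ q) (toP χ r)
axiom-derivable _ (p , _ , q) (Nec φ ψ) = □⇒⇝ (toP φ p) (toP ψ q)
axiom-derivable _ ((p , q) , (r , _) , _) (Ext φ ψ χ) = LL+ (toP φ p) (toP ψ q) (toP χ r)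
axiom-derivable _ (p , _) (ID φ) = ID (toP φ p)
axiom-derivable _ ((p , q , r) , _) (SH φ ψ χ) = SH (toP φ p) (toP ψ q) (toP χ r)
axiom-derivable _ (q , (p , _) , _) (D* φ ψ) = ⇝-D* (toP φ p) (toP ψ q)

theorem2 : ((C : FForm) (f : Flat C) → Axiom C → ⊢ C *[ f ])
    × ((C D : FForm) (f : Flat C) (g : Flat D) → ⊢ (C ⇒ D) *[ f , g ] → ⊢ C *[ f ] → ⊢ D *[ g ])
    × ((φ : PForm) → ⊢ ⌜ φ ⌝ → ⊢ (~ φ) ⇝ bot)
-- `MP` applies as it stands because the translation commutes with `⇒` definitionally.
theorem2 = axiom-derivable , (λ _ _ _ _ → MP) , □-necessitation
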